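{- Let $s\geq 1$, $d\geq 1$ and $m\geq 2$ be integers with $m\geq sd$, and let $n=m-1$. Let $\mathcal{C}_m^{s,d}$ be the set of circular preferences (assignments of an admissible $s$-tuple to each of the $n$ cars) and, for $A\in\mathcal{C}_m^{s,d}$, let $E(A)\in\mathbb{Z}_m$ be the unique spot left empty after circular parking. Then for every spot $j\in\mathbb{Z}_m$, $$\bigl|\{A\in\mathcal{C}_m^{s,d}:\ E(A)=j\}\bigr|=m^{\,n-1}\binom{m-sd+s-1}{s-1}^{n}.$$
   Context: Let $m\geq 2$. The spots are the elements of $\mathbb{Z}_m=\{1,\dots,m\}$, arranged clockwise on a circle. For $x\in\mathbb{Z}_m$ and an integer $k\geq 0$, $x\oplus k$ denotes clockwise displacement of $x$ by $k$, i.e. addition modulo $m$. Admissible tuples: fix integers $s\geq 1$ and $d\geq 1$. An admissible $s$-tuple is a tuple $(a_1,\dots,a_s)=\bigl(a,\ a\oplus k_1,\ a\oplus(k_1+k_2),\ \dots,\ a\oplus(k_1+\cdots+k_{s-1})\bigr)$ with $a\in\mathbb{Z}_m$ (the anchor) and integers $k_i\geq d$ for $1\le i\le s-1$ (the increments) such that $k_1+\cdots+k_{s-1}\leq m-d$ (for $s=1$ the sum is empty and equals $0$). Circular parking: let $n=m-1$. Cars $c_1,\dots,c_n$ enter in this order, each carrying an admissible $s$-tuple; all spots are initially free. Each car tries the spots of its tuple in the order $a_1,a_2,\dots,a_s$ and parks in the first one that is free; if all of them are occupied, it sweeps clockwise starting from its last choice $a_s$ (visiting $a_s\oplus 1, a_s\oplus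 2,\dots$) and parks in the first free spot. A circular preference $A$ is a choice of an admissible $s$-tuple for each of the $n$ cars; the set of circular preferences is $\mathcal{C}_m^{s,d}$. Since $n<m$, every car parks and exactly one spot, denoted $E(A)$, remains empty. -}

module Defs where

open import Data.Fin.Base using (Fin; zero; suc; toℕ)
open import Data.Fin.Properties using (toℕ<n; toℕ-injective; toℕ-fromℕ<)
open import Data.Fin.Subset using (Subset; inside; outside; ⊥; _∈_; _∉_; ∣_∣)
open import Data.Fin.Subset.Properties using (_∈?_; ∈⊤; ∣⊥∣≡0; ∣p∣≡n⇒p≡⊤; drop-there)
open import Data.List.Base as List using (List; _++_; find; applyUpTo)
import Data.List.Membership.Propositional as List∈
open import Data.List.Membership.Propositional.Properties using (∈-++⁺ʳ; ∈-applyUpTo⁺)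
open import Data.List.Relation.Unary.Any using (here; there)
open import Data.Maybe.Base using (Maybe; just; maybe′)
open import Data.Nat.Base using (ℕ; zero; suc; _+_; _∸_; _≤_; _<_; s≤s)
open import Data.Nat.DivMod using (_mod_; _%_; m%n<n; m<n⇒m%n≡m; [m+n]%n≡m%n)
open import Data.Nat.Properties
open import Data.Product using (∃-syntax; ∃₂; ∃!; _×_; _,_; proj₁; proj₂)
open import Data.Refinement.Base using (Refinement-syntax; value)
import Data.Vec.Base as Vec
open import Data.Vec.Base using (Vec; []; _∷_; map; last; sum; foldl′; toList; _[_]≔_)
open import Data.Vec.Relation.Unary.All using (All)
open import Relation.Binary.PropositionalEquality
open import Relation.Nullary using (¬?; yes; no; contradiction)

private
  variable
    r n l : ℕ

-- The spots are the residues modulo suc n; the label m of the last spot is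
-- represented by 0.
infixl 6 _⊕_
_⊕_ : Fin (suc n) → ℕ → Fin (suc n)
_⊕_ {n} x k = (toℕ x + k) mod suc n

-- 0, k₁, k₁ + k₂, …, k₁ + ⋯ + kᵣ
partialSums : Vec ℕ r → Vec ℕ (suc r)
partialSums []       = 0 ∷ []
partialSums (k ∷ ks) = 0 ∷ map (k +_) (partialSums ks)

-- The bound k₁ + ⋯ + kᵣ ≤ m - d is an inequality of integers; adding d on the
-- left avoids truncated subtraction.
Admissible : ℕ → Vec (Fin (suc n)) (suc r) → Set
Admissible {n} {r} d t =
  ∃₂ λ (a : Fin (suc n)) (ks : Vec ℕ r) →
    All (d ≤_) ks × sum ks + d ≤ suc n × t ≡ map (a ⊕_) (partialSums ks)

-- The witness of admissibility is irrelevant, so two elements are equal exactly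
-- when the underlying tuples of spots are.
AdmissibleTuple : (r d n : ℕ) → Set
AdmissibleTuple r d n = [ t ∈ Vec (Fin (suc n)) (suc r) ∣ Admissible d t ]

CircularPreference : (r d n : ℕ) → Set
CircularPreference r d n = Vec (AdmissibleTuple r d n) n

-- One full clockwise lap starting after the last choice visits every spot.
visits : Vec (Fin (suc n)) (suc r) → List (Fin (suc n))
visits {n} t = toList t ++ applyUpTo (λ i → last t ⊕ suc i) (suc n)

firstFree : Subset (suc n) → Vec (Fin (suc n)) (suc r) → Maybe (Fin (suc n))
firstFree occ t = find (λ x → ¬? (x ∈? occ)) (visits t)

-- The default value is only used when there is no free spot at all.
park : Subset (suc n) → Vec (Fin (suc n)) (suc r) → Subset (suc n)
park occ t = maybe′ (λ x → occ [ x ]≔ inside) occ (firstFree occ t)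

occupied : ∀ {d} → Vec (AdmissibleTuple r d n) l → Subset (suc n)
occupied = foldl′ (λ occ t → park occ (value t)) ⊥

private
  ⊕-reaches : (a x : Fin (suc n)) → ∃[ i ] i < suc n × x ≡ a ⊕ suc i
  ⊕-reaches {n} a x with toℕ a <? toℕ x
  ... | yes a<x = i , ≤-<-trans (m∸n≤m (toℕ x) (suc (toℕ a))) (toℕ<n x) , toℕ-injective (begin
        toℕ x                    ≡⟨ m<n⇒m%n≡m (toℕ<n x) ⟨
        toℕ x % suc n            ≡⟨ cong (_% suc n) eq ⟨
        (toℕ a + suc i) % suc n  ≡⟨ toℕ-fromℕ< (m%n<n (toℕ a + suc i) (suc n)) ⟨
        toℕ (a ⊕ suc i)          ∎)
    where
    open ≡-Reasoning
    i = toℕ x ∸ suc (toℕ a)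
    eq : toℕ a + suc i ≡ toℕ x
    eq = trans (+-suc (toℕ a) i) (m+[n∸m]≡n a<x)
  ... | no a≮x = i , s≤s i≤n , toℕ-injective (begin
        toℕ x                    ≡⟨ m<n⇒m%n≡m (toℕ<n x) ⟨
        toℕ x % suc n            ≡⟨ [m+n]%n≡m%n (toℕ x) (suc n) ⟨
        (toℕ x + suc n) % suc n  ≡⟨ cong (_% suc n) eq ⟨
        (toℕ a + suc i) % suc n  ≡⟨ toℕ-fromℕ< (m%n<n (toℕ a + suc i) (suc n)) ⟨
        toℕ (a ⊕ suc i)          ∎)
    where
    open ≡-Reasoning
    i = toℕ x + n ∸ toℕ a
    i≤n : i ≤ n
    i≤n = ≤-trans (∸-monoˡ-≤ (toℕ a) (+-monoˡ-≤ n (≮⇒≥ a≮x))) (≤-reflexive (m+n∸m≡n (toℕ a) n))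
    eq : toℕ a + suc i ≡ toℕ x + suc n
    eq = trans (+-suc (toℕ a) i)
        (trans (cong suc (m+[n∸m]≡n (≤-trans (≤-pred (toℕ<n a)) (m≤n+m n (toℕ x)))))
               (sym (+-suc (toℕ x) n)))

∈-visits : (t : Vec (Fin (suc n)) (suc r)) (x : Fin (suc n)) → x List∈.∈ visits t
∈-visits t x with i , i<m , refl ← ⊕-reaches (last t) x =
  ∈-++⁺ʳ (toList t) (∈-applyUpTo⁺ (λ k → last t ⊕ suc k) i<m)

private
  find-free : (occ : Subset l) (xs : List (Fin l)) {x : Fin l} → x List∈.∈ xs → x ∉ occ →
              ∃[ y ] find (λ z → ¬? (z ∈? occ)) xs ≡ just y × y ∉ occ
  find-free occ (y List.∷ ys) x∈ x∉ with y ∈? occ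
  ... | no  y∉ = y , refl , y∉
  find-free occ (y List.∷ ys) (here refl) x∉ | yes y∈ = contradiction y∈ x∉
  find-free occ (y List.∷ ys) (there x∈)  x∉ | yes y∈ = find-free occ ys x∈ x∉

  free-exists : (p : Subset l) → ∣ p ∣ < l → ∃[ x ] x ∉ p
  free-exists (outside ∷ p) _       = zero , λ ()
  free-exists (inside  ∷ p) (s≤s h) with x , x∉ ← free-exists p h = suc x , λ x∈ → x∉ (drop-there x∈)

  ∣insert∣ : (p : Subset l) (x : Fin l) → x ∉ p → ∣ p [ x ]≔ inside ∣ ≡ suc ∣ p ∣
  ∣insert∣ (inside  ∷ p) zero    x∉ = contradiction Vec.here x∉
  ∣insert∣ (outside ∷ p) zero    x∉ = refl
  ∣insert∣ (inside  ∷ p) (suc x) x∉ = cong suc (∣insert∣ p x λ x∈ → x∉ (Vec.there x∈))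
  ∣insert∣ (outside ∷ p) (suc x) x∉ = ∣insert∣ p x λ x∈ → x∉ (Vec.there x∈)

firstFree-just : (occ : Subset (suc n)) (t : Vec (Fin (suc n)) (suc r)) → ∣ occ ∣ < suc n →
                 ∃[ x ] firstFree occ t ≡ just x × x ∉ occ
firstFree-just occ t h with x , x∉ ← free-exists occ h = find-free occ (visits t) (∈-visits t x) x∉

∣park∣ : (occ : Subset (suc n)) (t : Vec (Fin (suc n)) (suc r)) → ∣ occ ∣ < suc n →
         ∣ park occ t ∣ ≡ suc ∣ occ ∣
∣park∣ occ t h with y , eq , y∉ ← firstFree-just occ t h rewrite eq = ∣insert∣ occ y y∉

private
  ∣foldl-park∣ : ∀ {d} (occ : Subset (suc n)) (A : Vec (AdmissibleTuple r d n) l) →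
                 ∣ occ ∣ + l ≤ suc n →
                 ∣ foldl′ (λ o t → park o (value t)) occ A ∣ ≡ ∣ occ ∣ + l
  ∣foldl-park∣ occ [] _ = sym (+-identityʳ ∣ occ ∣)
  ∣foldl-park∣ {n = n} {l = suc l} occ (t ∷ A) h =
    trans (∣foldl-park∣ (park occ (value t)) A (subst (_≤ suc n) (sym eq) h)) eq
    where
    eq : ∣ park occ (value t) ∣ + l ≡ ∣ occ ∣ + suc l
    eq = trans (cong (_+ l) (∣park∣ occ (value t) (≤-trans (s≤s (m≤m+n ∣ occ ∣ l))
                                (subst (_≤ suc n) (+-suc ∣ occ ∣ l) h))))
               (sym (+-suc ∣ occ ∣ l))

  unique-free : (p : Subset (suc l)) → ∣ p ∣ ≡ l → ∃! _≡_ (_∉ p)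
  unique-free (outside ∷ p) h = zero , (λ ()) , λ {x} → uniq x
    where
    uniq : ∀ x → x ∉ outside ∷ p → zero ≡ x
    uniq zero    _  = refl
    uniq (suc x) x∉ = contradiction (Vec.there (subst (x ∈_) (sym (∣p∣≡n⇒p≡⊤ h)) ∈⊤)) x∉
  unique-free {suc l} (inside ∷ p) h with x , x∉ , x-uniq ← unique-free p (suc-injective h) =
    suc x , (λ x∈ → x∉ (drop-there x∈)) , λ {y} → uniq y
    where
    uniq : ∀ y → y ∉ inside ∷ p → suc x ≡ y
    uniq zero    y∉ = contradiction Vec.here y∉
    uniq (suc y) y∉ = cong suc (x-uniq λ y∈ → y∉ (Vec.there y∈))

∣occupied∣ : ∀ {d} (A : CircularPreference r d n) → ∣ occupied A ∣ ≡ n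
∣occupied∣ {n = n} A =
  trans (∣foldl-park∣ ⊥ A (subst (λ k → k + n ≤ suc n) (sym (∣⊥∣≡0 (suc n))) (n≤1+n n)))
        (cong (_+ n) (∣⊥∣≡0 (suc n)))

uniqueEmptySpot : ∀ {d} (A : CircularPreference r d n) → ∃! _≡_ (_∉ occupied A)
uniqueEmptySpot A = unique-free (occupied A) (∣occupied∣ A)

E : ∀ {d} → CircularPreference r d n → Fin (suc n)
E A = proj₁ (uniqueEmptySpot A)

{-# OPTIONS --safe #-}

-- Rotating all the tuples of a preference rotates the parking outcome, so both
-- the empty spot and the anchor of the first car are equivariant for a free
-- action of ℤ_m.  Any two fibres of equivariant maps to ℤ_m are in bijection:
-- rotate each element of one fibre by the unique amount that takes it into the
-- other.  Hence the preferences with empty spot j correspond to those whose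
-- first car is anchored at 0, and these are counted by stars and bars.
module Submission where

open import Defs
open import Data.Fin.Base using (Fin; zero; toℕ)
open import Data.Fin.Properties as Fin
  using (toℕ<n; toℕ-injective; toℕ-fromℕ<; +↔⊎; *↔×; 1↔⊤)
open import Data.Fin.Subset using (Subset; inside; _∈_)
open import Data.Fin.Subset.Properties using (_∈?_; ∉⊥)
open import Data.Irrelevant using ([_])
open import Data.List.Base as List using (List; find)
open import Data.List.Properties using (map-++; map-applyUpTo)
open import Data.Maybe.Base as Maybe using (just; nothing)
open import Data.Nat.Base using (ℕ; zero; suc; _+_; _∸_; _*_; _^_; _%_; _≤_; _<_; z≤n; s≤s)
open import Data.Nat.Combinatorics using (_C_; nCn≡1; nCk+nC[k+1]≡[n+1]C[k+1])
open import Data.Nat.DivMod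
  using (%-distribˡ-+; m%n%n≡m%n; m%n<n; m<n⇒m%n≡m; [m+n]%n≡m%n)
open import Data.Nat.Properties
open import Algebra.Properties.CommutativeSemigroup *-commutativeSemigroup
  using (x∙yz≈y∙xz; interchange)
open import Data.Product.Base using (Σ-syntax; _×_; _,_; proj₁; proj₂)
open import Data.Product.Function.NonDependent.Propositional using (_×-↔_)
open import Data.Refinement.Base using (Refinement-syntax; value; _,_)
open import Data.Refinement.Properties using (value-injective)
open import Data.Sum.Base using (_⊎_; inj₁; inj₂)
open import Data.Sum.Function.Propositional using (_⊎-↔_)
open import Data.Unit.Base using (tt)
open import Data.Vec.Base using (Vec; []; _∷_; map; last; sum; head; toList; foldl′; _[_]≔_)
open import Data.Vec.Properties as Vec
  using (toList-map; map-∘; map-cong; map-id; lookup⇒[]=; []=⇒lookup; lookup∘update; lookup∘update′)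
open import Data.Vec.Relation.Unary.All using (All; []; _∷_)
open import Function.Base using (_∘_)
open import Function.Bundles using (_↔_; _⇔_; mk↔ₛ′; mk⇔; module Equivalence; module Inverse)
open import Function.Properties.Inverse using (↔-refl; ↔-sym; ↔-trans)
open import Relation.Binary.PropositionalEquality
open import Relation.Nullary using (yes; no; contradiction; ¬?)
open import Relation.Nullary.Decidable using (recompute)

private
  variable
    r d n l k : ℕ

-- Rotations of the circle

toℕ-⊕ : (x : Fin (suc n)) (k : ℕ) → toℕ (x ⊕ k) ≡ (toℕ x + k) % suc n
toℕ-⊕ {n} x k = toℕ-fromℕ< (m%n<n (toℕ x + k) (suc n))

[m%d+n]%d≡[m+n]%d : ∀ m n d → (m % suc d + n) % suc d ≡ (m + n) % suc d
[m%d+n]%d≡[m+n]%d m n d = begin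
  (m % suc d + n) % suc d                    ≡⟨ %-distribˡ-+ (m % suc d) n (suc d) ⟩
  (m % suc d % suc d + n % suc d) % suc d    ≡⟨ cong (λ z → (z + n % suc d) % suc d) (m%n%n≡m%n m (suc d)) ⟩
  (m % suc d + n % suc d) % suc d            ≡⟨ %-distribˡ-+ m n (suc d) ⟨
  (m + n) % suc d                            ∎
  where open ≡-Reasoning

⊕-assoc : (x : Fin (suc n)) (k l : ℕ) → (x ⊕ k) ⊕ l ≡ x ⊕ (k + l)
⊕-assoc {n} x k l = toℕ-injective (begin
  toℕ ((x ⊕ k) ⊕ l)                  ≡⟨ toℕ-⊕ (x ⊕ k) l ⟩
  (toℕ (x ⊕ k) + l) % suc n          ≡⟨ cong (λ z → (z + l) % suc n) (toℕ-⊕ x k) ⟩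
  ((toℕ x + k) % suc n + l) % suc n  ≡⟨ [m%d+n]%d≡[m+n]%d (toℕ x + k) l n ⟩
  (toℕ x + k + l) % suc n            ≡⟨ cong (_% suc n) (+-assoc (toℕ x) k l) ⟩
  (toℕ x + (k + l)) % suc n          ≡⟨ toℕ-⊕ x (k + l) ⟨
  toℕ (x ⊕ (k + l))                  ∎)
  where open ≡-Reasoning

⊕-identityʳ : (x : Fin (suc n)) → x ⊕ 0 ≡ x
⊕-identityʳ {n} x = toℕ-injective (trans (toℕ-⊕ x 0)
  (trans (cong (_% suc n) (+-identityʳ (toℕ x))) (m<n⇒m%n≡m (toℕ<n x))))

⊕-swap : (x : Fin (suc n)) (k l : ℕ) → (x ⊕ k) ⊕ l ≡ (x ⊕ l) ⊕ k
⊕-swap x k l = trans (⊕-assoc x k l) (trans (cong (x ⊕_) (+-comm k l)) (sym (⊕-assoc x l k)))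

-- The residue of y - x in the range 0, ..., n. The summand `suc n ∸ toℕ x` represents -x modulo m;
-- as `toℕ x < suc n`, nothing is truncated.
clockwiseDistance : Fin (suc n) → Fin (suc n) → ℕ
clockwiseDistance {n} x y = (toℕ y + (suc n ∸ toℕ x)) % suc n

⊕-clockwiseDistance : (x y : Fin (suc n)) → x ⊕ clockwiseDistance x y ≡ y
⊕-clockwiseDistance {n} x y = toℕ-injective (begin
  toℕ (x ⊕ clockwiseDistance x y)                    ≡⟨ toℕ-⊕ x (clockwiseDistance x y) ⟩
  (toℕ x + (toℕ y + (suc n ∸ toℕ x)) % suc n) % suc n  ≡⟨ cong (_% suc n) (+-comm (toℕ x) _) ⟩
  ((toℕ y + (suc n ∸ toℕ x)) % suc n + toℕ x) % suc n  ≡⟨ [m%d+n]%d≡[m+n]%d (toℕ y + (suc n ∸ toℕ x)) (toℕ x) n ⟩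
  (toℕ y + (suc n ∸ toℕ x) + toℕ x) % suc n          ≡⟨ cong (_% suc n) (+-assoc (toℕ y) _ (toℕ x)) ⟩
  (toℕ y + (suc n ∸ toℕ x + toℕ x)) % suc n          ≡⟨ cong (λ z → (toℕ y + z) % suc n) (m∸n+n≡m (<⇒≤ (toℕ<n x))) ⟩
  (toℕ y + suc n) % suc n                            ≡⟨ [m+n]%n≡m%n (toℕ y) (suc n) ⟩
  toℕ y % suc n                                      ≡⟨ m<n⇒m%n≡m (toℕ<n y) ⟩
  toℕ y                                              ∎)
  where open ≡-Reasoning

clockwiseDistance-⊕ : (x : Fin (suc n)) → k < suc n → clockwiseDistance x (x ⊕ k) ≡ k
clockwiseDistance-⊕ {n} {k} x k<m = begin
  (toℕ (x ⊕ k) + (suc n ∸ toℕ x)) % suc n            ≡⟨ cong (λ z → (z + (suc n ∸ toℕ x)) % suc n) (toℕ-⊕ x k) ⟩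
  ((toℕ x + k) % suc n + (suc n ∸ toℕ x)) % suc n    ≡⟨ [m%d+n]%d≡[m+n]%d (toℕ x + k) (suc n ∸ toℕ x) n ⟩
  (toℕ x + k + (suc n ∸ toℕ x)) % suc n              ≡⟨ cong (λ z → (z + (suc n ∸ toℕ x)) % suc n) (+-comm (toℕ x) k) ⟩
  (k + toℕ x + (suc n ∸ toℕ x)) % suc n              ≡⟨ cong (_% suc n) (+-assoc k (toℕ x) _) ⟩
  (k + (toℕ x + (suc n ∸ toℕ x))) % suc n            ≡⟨ cong (λ z → (k + z) % suc n) (m+[n∸m]≡n (<⇒≤ (toℕ<n x))) ⟩
  (k + suc n) % suc n                                ≡⟨ [m+n]%n≡m%n k (suc n) ⟩
  k % suc n                                          ≡⟨ m<n⇒m%n≡m k<m ⟩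
  k                                                  ∎
  where open ≡-Reasoning

-- Displacements commute and y is itself a displacement of x, so whether k and l agree modulo m can
-- be tested at any single spot.
⊕-transport : (x y : Fin (suc n)) {k l : ℕ} → x ⊕ k ≡ x ⊕ l → y ⊕ k ≡ y ⊕ l
⊕-transport x y {k} {l} eq with δ ← clockwiseDistance x y | refl ← ⊕-clockwiseDistance x y =
  trans (⊕-swap x δ k) (trans (cong (_⊕ δ) eq) (⊕-swap x l δ))

-- The displacement δ leading from `x ⊕ k` back to x undoes k at every spot: `k + δ` agrees with 0
-- at x, hence everywhere by `⊕-transport`.
⊕-injective : (x y : Fin (suc n)) → x ⊕ k ≡ y ⊕ k → x ≡ y
⊕-injective {k = k} x y eq with δ ← clockwiseDistance (x ⊕ k) x in p =
  trans (sym (back x)) (trans (cong (_⊕ δ) eq) (back y))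
  where
  back : ∀ z → (z ⊕ k) ⊕ δ ≡ z
  back z = trans (⊕-assoc z k δ) (trans (⊕-transport x z (trans (sym (⊕-assoc x k δ))
    (trans (cong ((x ⊕ k) ⊕_) (sym p)) (trans (⊕-clockwiseDistance (x ⊕ k) x) (sym (⊕-identityʳ x))))))
    (⊕-identityʳ z))

-- Fibres of equivariant maps

fibre-≡ : {C : Set} {f : C → Fin n} {i : Fin n} {x y : C} {p : f x ≡ i} {q : f y ≡ i} →
          x ≡ y → _≡_ {A = Σ[ x ∈ C ] f x ≡ i} (x , p) (y , q)
fibre-≡ {p = refl} {refl} refl = refl

-- An action of ℤ_m, encoded with natural numbers as amounts. An amount fixing some spot is a
-- multiple of m, so `▷-trivial` makes the action depend on residues only.
module _ {C : Set} (_▷_ : C → ℕ → C)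
         (▷-assoc : ∀ x k l → (x ▷ k) ▷ l ≡ x ▷ (k + l))
         (▷-trivial : ∀ x (i : Fin (suc n)) k → i ⊕ k ≡ i → x ▷ k ≡ x)
         where

  private
    move : (f g : C → Fin (suc n)) (g-▷ : ∀ x k → g (x ▷ k) ≡ g x ⊕ k) (i j : Fin (suc n)) →
           Σ[ x ∈ C ] f x ≡ i → Σ[ x ∈ C ] g x ≡ j
    move f g g-▷ i j (x , _) = x ▷ δ , trans (g-▷ x δ) (⊕-clockwiseDistance (g x) j)
      where δ = clockwiseDistance (g x) j

    -- The amounts δ and ε together return `f x` to itself, so their sum acts trivially. With f and
    -- g exchanged, this gives the other inverse law too.
    move-move : (f g : C → Fin (suc n))
                (f-▷ : ∀ x k → f (x ▷ k) ≡ f x ⊕ k) (g-▷ : ∀ x k → g (x ▷ k) ≡ g x ⊕ k)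
                (i j : Fin (suc n)) (p : Σ[ x ∈ C ] f x ≡ i) →
                move g f f-▷ j i (move f g g-▷ i j p) ≡ p
    move-move f g f-▷ g-▷ i j (x , refl) = fibre-≡ (trans (▷-assoc x δ ε)
      (▷-trivial x (f x) (δ + ε) (begin
        f x ⊕ (δ + ε)    ≡⟨ ⊕-assoc (f x) δ ε ⟨
        (f x ⊕ δ) ⊕ ε    ≡⟨ cong (_⊕ ε) (f-▷ x δ) ⟨
        f (x ▷ δ) ⊕ ε    ≡⟨ ⊕-clockwiseDistance (f (x ▷ δ)) (f x) ⟩
        f x              ∎)))
      where
      open ≡-Reasoning
      δ = clockwiseDistance (g x) j
      ε = clockwiseDistance (f (x ▷ δ)) (f x)

  equivariant-fibres-↔ : (f g : C → Fin (suc n)) →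
    (∀ x k → f (x ▷ k) ≡ f x ⊕ k) → (∀ x k → g (x ▷ k) ≡ g x ⊕ k) →
    ∀ i j → (Σ[ x ∈ C ] f x ≡ i) ↔ (Σ[ x ∈ C ] g x ≡ j)
  equivariant-fibres-↔ f g f-▷ g-▷ i j =
    mk↔ₛ′ (move f g g-▷ i j) (move g f f-▷ j i)
          (move-move g f g-▷ f-▷ j i) (move-move f g f-▷ g-▷ i j)

-- Equivariance of parking

last-map : {A B : Set} (f : A → B) (xs : Vec A (suc n)) → last (map f xs) ≡ f (last xs)
last-map f (x ∷ [])     = refl
last-map f (x ∷ y ∷ xs) = last-map f (y ∷ xs)

applyUpTo-cong : {A : Set} {f g : ℕ → A} → (∀ i → f i ≡ g i) → ∀ n →
                 List.applyUpTo f n ≡ List.applyUpTo g n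
applyUpTo-cong f≗g zero    = refl
applyUpTo-cong f≗g (suc n) = cong₂ List._∷_ (f≗g 0) (applyUpTo-cong (f≗g ∘ suc) n)

rotate : ℕ → Vec (Fin (suc n)) l → Vec (Fin (suc n)) l
rotate k = map (_⊕ k)

-- The sweep is laid out relative to the last choice, so it rotates along with the tuple because
-- displacements commute.
visits-rotate : (k : ℕ) (t : Vec (Fin (suc n)) (suc r)) →
                visits (rotate k t) ≡ List.map (_⊕ k) (visits t)
visits-rotate {n} k t = begin
  toList (rotate k t) List.++ List.applyUpTo (λ i → last (rotate k t) ⊕ suc i) (suc n)
    ≡⟨ cong₂ List._++_ (toList-map (_⊕ k) t)
         (applyUpTo-cong (λ i → trans (cong (_⊕ suc i) (last-map (_⊕ k) t)) (⊕-swap (last t) k (suc i))) (suc n)) ⟩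
  List.map (_⊕ k) (toList t) List.++ List.applyUpTo (λ i → (last t ⊕ suc i) ⊕ k) (suc n)
    ≡⟨ cong (List.map (_⊕ k) (toList t) List.++_) (map-applyUpTo (λ i → last t ⊕ suc i) (_⊕ k) (suc n)) ⟨
  List.map (_⊕ k) (toList t) List.++ List.map (_⊕ k) (List.applyUpTo (λ i → last t ⊕ suc i) (suc n))
    ≡⟨ map-++ (_⊕ k) (toList t) _ ⟨
  List.map (_⊕ k) (visits t) ∎
  where open ≡-Reasoning

-- Says that q is the image of p under the rotation, phrased through membership because that is what
-- a car tests at each spot.
RotatedBy : ℕ → Subset (suc n) → Subset (suc n) → Set
RotatedBy k p q = ∀ x → x ∈ p ⇔ x ⊕ k ∈ q

module _ {k : ℕ} {p q : Subset (suc n)} (p~q : RotatedBy k p q) where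

  -- At each step both searches meet corresponding spots, which are free or occupied together, so
  -- they stop at the same position.
  find-rotated : (xs : List (Fin (suc n))) →
    find (λ x → ¬? (x ∈? q)) (List.map (_⊕ k) xs) ≡ Maybe.map (_⊕ k) (find (λ x → ¬? (x ∈? p)) xs)
  find-rotated List.[] = refl
  find-rotated (x List.∷ xs) with x ∈? p | (x ⊕ k) ∈? q
  ... | yes _   | yes _   = find-rotated xs
  ... | yes x∈p | no  x∉q = contradiction (Equivalence.to (p~q x) x∈p) x∉q
  ... | no  x∉p | yes x∈q = contradiction (Equivalence.from (p~q x) x∈q) x∉p
  ... | no  _   | no  _   = refl

  -- A spot y other than x stays different from x after rotation, by injectivity, so neither update
  -- affects the memberships of y and `y ⊕ k`.
  insert-rotated : ∀ x → RotatedBy k (p [ x ]≔ inside) (q [ x ⊕ k ]≔ inside)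
  insert-rotated x y with y Fin.≟ x
  ... | yes refl = mk⇔ (λ _ → lookup⇒[]= _ _ (lookup∘update (x ⊕ k) q inside))
                       (λ _ → lookup⇒[]= _ _ (lookup∘update x p inside))
  ... | no y≢x = mk⇔
    (λ y∈ → lookup⇒[]= _ _ (trans (lookup∘update′ (y≢x ∘ ⊕-injective y x) q inside)
              ([]=⇒lookup (Equivalence.to (p~q y)
                (lookup⇒[]= y p (trans (sym (lookup∘update′ y≢x p inside)) ([]=⇒lookup y∈)))))))
    (λ y∈ → lookup⇒[]= _ _ (trans (lookup∘update′ y≢x p inside)
              ([]=⇒lookup (Equivalence.from (p~q y)
                (lookup⇒[]= (y ⊕ k) q (trans (sym (lookup∘update′ (y≢x ∘ ⊕-injective y x) q inside)) ([]=⇒lookup y∈)))))))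

  park-rotated : (t : Vec (Fin (suc n)) (suc r)) → RotatedBy k (park p t) (park q (rotate k t))
  park-rotated t
    -- This expresses the spot found in q through `firstFree p t`, so that a single case split
    -- decides both parkings.
    rewrite trans (cong (find (λ x → ¬? (x ∈? q))) (visits-rotate k t)) (find-rotated (visits t))
    with firstFree p t
  ... | just x  = insert-rotated x
  ... | nothing = p~q

map-⊕-partialSums : (a : Fin (suc n)) (k : ℕ) (ks : Vec ℕ l) →
                    rotate k (map (a ⊕_) (partialSums ks)) ≡ map ((a ⊕ k) ⊕_) (partialSums ks)
map-⊕-partialSums a k ks = trans (sym (map-∘ (_⊕ k) (a ⊕_) (partialSums ks)))
  (map-cong (λ x → ⊕-swap a x k) (partialSums ks))

rotateTuple : ℕ → AdmissibleTuple r d n → AdmissibleTuple r d n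
rotateTuple k (t , [ adm ]) = rotate k t , [ rotated adm ]
  where
  rotated : Admissible _ t → Admissible _ (rotate k t)
  rotated (a , ks , ≥d , ≤m , refl) = a ⊕ k , ks , ≥d , ≤m , map-⊕-partialSums a k ks

rotateAll : ℕ → Vec (AdmissibleTuple r d n) l → Vec (AdmissibleTuple r d n) l
rotateAll k = map (rotateTuple k)

foldl-park-rotated : {p q : Subset (suc n)} → RotatedBy k p q → (A : Vec (AdmissibleTuple r d n) l) →
  RotatedBy k (foldl′ (λ o t → park o (value t)) p A) (foldl′ (λ o t → park o (value t)) q (rotateAll k A))
foldl-park-rotated p~q []      = p~q
foldl-park-rotated p~q (t ∷ A) = foldl-park-rotated (park-rotated p~q (value t)) A

occupied-rotated : (k : ℕ) (A : Vec (AdmissibleTuple r d n) l) →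
                   RotatedBy k (occupied A) (occupied (rotateAll k A))
occupied-rotated k = foldl-park-rotated (λ _ → mk⇔ (λ x∈ → contradiction x∈ ∉⊥) (λ x∈ → contradiction x∈ ∉⊥))

-- If `E A ⊕ k` were occupied after the rotation, `E A` would be occupied before it. So `E A ⊕ k` is
-- free, and the free spot is unique.
E-rotate : (A : CircularPreference r d n) (k : ℕ) → E (rotateAll k A) ≡ E A ⊕ k
E-rotate A k with e , e∉ , _ ← uniqueEmptySpot A | _ , _ , uniq ← uniqueEmptySpot (rotateAll k A) =
  uniq (e∉ ∘ Equivalence.from (occupied-rotated k A e))

rotateAll-assoc : (A : Vec (AdmissibleTuple r d n) l) (k j : ℕ) →
                  rotateAll j (rotateAll k A) ≡ rotateAll (k + j) A
rotateAll-assoc A k j = trans (sym (map-∘ (rotateTuple j) (rotateTuple k) A))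
  (map-cong (λ t → value-injective (trans (sym (map-∘ (_⊕ j) (_⊕ k) (value t)))
    (map-cong (λ x → ⊕-assoc x k j) (value t)))) A)

-- At the spot i the amount k agrees with 0, hence by `⊕-transport` at every spot of every tuple.
rotateAll-trivial : (A : Vec (AdmissibleTuple r d n) l) (i : Fin (suc n)) (k : ℕ) → i ⊕ k ≡ i →
                    rotateAll k A ≡ A
rotateAll-trivial A i k eq = trans
  (map-cong (λ t → value-injective (trans
    (map-cong (λ x → trans (⊕-transport i x (trans eq (sym (⊕-identityʳ i)))) (⊕-identityʳ x)) (value t))
    (map-id (value t)))) A)
  (map-id A)

-- Anchors and increments

Increments : (r d n : ℕ) → Set
Increments r d n = [ ks ∈ Vec ℕ r ∣ All (d ≤_) ks × sum ks + d ≤ suc n ]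

increments : Vec (Fin (suc n)) (suc r) → Vec ℕ r
increments {r = zero}  _       = []
increments {r = suc r} (x ∷ t) = clockwiseDistance x (head t) ∷ increments t

head-rotate : (k : ℕ) (t : Vec (Fin (suc n)) (suc r)) → head (rotate k t) ≡ head t ⊕ k
head-rotate k (x ∷ t) = refl

head-map-partialSums : (a : Fin (suc n)) (ks : Vec ℕ r) → head (map (a ⊕_) (partialSums ks)) ≡ a
head-map-partialSums a []       = ⊕-identityʳ a
head-map-partialSums a (k ∷ ks) = ⊕-identityʳ a

-- The bound keeps each increment below m, so that it equals the residue measured between
-- consecutive choices; the tail is the tuple anchored at `a ⊕ k`.
increments-partialSums : (a : Fin (suc n)) (ks : Vec ℕ r) → sum ks < suc n →
                         increments (map (a ⊕_) (partialSums ks)) ≡ ks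
increments-partialSums a []       _ = refl
increments-partialSums {n} a (k ∷ ks) <m = trans
  (cong₂ (λ x t → clockwiseDistance x (head t) ∷ increments t) (⊕-identityʳ a) tail≡)
  (cong₂ _∷_
    (trans (cong (clockwiseDistance a) (head-map-partialSums (a ⊕ k) ks))
           (clockwiseDistance-⊕ a (≤-<-trans (m≤m+n k (sum ks)) <m)))
    (increments-partialSums (a ⊕ k) ks (≤-<-trans (m≤n+m (sum ks) k) <m)))
  where
  tail≡ : map (a ⊕_) (map (k +_) (partialSums ks)) ≡ map ((a ⊕ k) ⊕_) (partialSums ks)
  tail≡ = trans (sym (map-∘ (a ⊕_) (k +_) (partialSums ks)))
                (map-cong (λ x → sym (⊕-assoc a k x)) (partialSums ks))

module _ (1≤d : 1 ≤ d) where

  private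
    -- Positivity of d keeps the increments short of a full lap, which is what lets them be read off
    -- from the spots.
    sum<m : (ks : Vec ℕ r) → sum ks + d ≤ suc n → sum ks < suc n
    sum<m ks ≤m = <-≤-trans (m<m+n (sum ks) 1≤d) ≤m

    increments-admissible : (t : Vec (Fin (suc n)) (suc r)) → Admissible d t →
      All (d ≤_) (increments t) × sum (increments t) + d ≤ suc n
    increments-admissible {n} t (a , ks , ≥d , ≤m , refl) =
      subst (λ ks → All (d ≤_) ks × sum ks + d ≤ suc n)
            (sym (increments-partialSums a ks (sum<m ks ≤m))) (≥d , ≤m)

    partialSums-increments : (t : Vec (Fin (suc n)) (suc r)) → Admissible d t →
      map (head t ⊕_) (partialSums (increments t)) ≡ t
    partialSums-increments t (a , ks , ≥d , ≤m , refl) =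
      cong₂ (λ a ks → map (a ⊕_) (partialSums ks))
            (head-map-partialSums a ks) (increments-partialSums a ks (sum<m ks ≤m))

  -- The irrelevant witness cannot be inspected, so anchor and increments are recovered from the
  -- spots: the head, since the partial sums begin with 0, and the consecutive clockwise distances.
  tuple↔anchor×increments : AdmissibleTuple r d n ↔ (Fin (suc n) × Increments r d n)
  tuple↔anchor×increments {r} {n} = mk↔ₛ′ to from to∘from from∘to
    where
    to : AdmissibleTuple r d n → Fin (suc n) × Increments r d n
    to (t , [ adm ]) = head t , (increments t , [ increments-admissible t adm ])

    from : Fin (suc n) × Increments r d n → AdmissibleTuple r d n
    from (a , (ks , [ h ])) = map (a ⊕_) (partialSums ks) , [ (a , ks , proj₁ h , proj₂ h , refl) ]

    to∘from : ∀ x → to (from x) ≡ x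
    to∘from (a , (ks , [ h ])) = cong₂ _,_ (head-map-partialSums a ks)
      (value-injective (increments-partialSums a ks
        -- The bound comes from an irrelevant proof; being decidable, it can be recomputed as a
        -- usable one.
        (recompute (sum ks <? suc n) (sum<m ks (proj₂ h)))))

    from∘to : ∀ t → from (to t) ≡ t
    from∘to (t , [ adm ]) = value-injective
      (recompute (Vec.≡-dec Fin._≟_ _ t) (partialSums-increments t adm))

-- Stars and bars

BoundedSum : (r N : ℕ) → Set
BoundedSum r N = [ v ∈ Vec ℕ r ∣ sum v ≤ N ]

boundedSum-split₀ : BoundedSum (suc r) 0 ↔ BoundedSum r 0
boundedSum-split₀ = mk↔ₛ′
  (λ { (zero ∷ v , [ p ]) → v , [ p ] })
  (λ { (v , [ p ]) → 0 ∷ v , [ p ] })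
  (λ { (v , [ p ]) → refl })
  (λ { (zero ∷ v , [ p ]) → refl })

-- Pascal's recursion: a first entry 0 is dropped, and a positive one is lowered by 1 together with
-- the bound.
boundedSum-split : ∀ {N} → BoundedSum (suc r) (suc N) ↔ (BoundedSum r (suc N) ⊎ BoundedSum (suc r) N)
boundedSum-split = mk↔ₛ′
  (λ { (zero ∷ v , [ p ]) → inj₁ (v , [ p ]) ; (suc k ∷ v , [ p ]) → inj₂ (k ∷ v , [ ≤-pred p ]) })
  (λ { (inj₁ (v , [ p ])) → 0 ∷ v , [ p ] ; (inj₂ (k ∷ v , [ p ])) → suc k ∷ v , [ s≤s p ] })
  (λ { (inj₁ (v , [ p ])) → refl ; (inj₂ (k ∷ v , [ p ])) → refl })
  (λ { (zero ∷ v , [ p ]) → refl ; (suc k ∷ v , [ p ]) → refl })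

≡⇒Fin↔ : ∀ {m n} → m ≡ n → Fin m ↔ Fin n
≡⇒Fin↔ refl = ↔-refl

-- The slack below N acts as one further part, so these are the weak compositions of N into `suc r`
-- parts.
boundedSum↔Fin : ∀ r N → BoundedSum r N ↔ Fin ((N + r) C r)
boundedSum↔Fin zero N = ↔-trans
  (mk↔ₛ′ (λ _ → tt) (λ _ → [] , [ z≤n ]) (λ _ → refl) (λ { ([] , [ _ ]) → refl }))
  (↔-sym 1↔⊤)
boundedSum↔Fin (suc r) zero = ↔-trans boundedSum-split₀ (↔-trans (boundedSum↔Fin r zero)
  (≡⇒Fin↔ (trans (nCn≡1 r) (sym (nCn≡1 (suc r))))))
boundedSum↔Fin (suc r) (suc N) = ↔-trans boundedSum-split
  (↔-trans (boundedSum↔Fin r (suc N) ⊎-↔ boundedSum↔Fin (suc r) N)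
  (↔-trans (↔-sym +↔⊎) (≡⇒Fin↔ pascal)))
  where
  open ≡-Reasoning
  pascal : suc (N + r) C r + (N + suc r) C suc r ≡ suc (N + suc r) C suc r
  pascal = begin
    suc (N + r) C r + (N + suc r) C suc r  ≡⟨ cong (λ z → z C r + (N + suc r) C suc r) (+-suc N r) ⟨
    (N + suc r) C r + (N + suc r) C suc r  ≡⟨ nCk+nC[k+1]≡[n+1]C[k+1] (N + suc r) r ⟩
    suc (N + suc r) C suc r                ∎

-- The r increments contribute r copies of d, and the closing gap of at least d contributes one
-- more: this is the s * d of the count.
sum-map-+ : (d : ℕ) (v : Vec ℕ r) → sum (map (d +_) v) + d ≡ sum v + suc r * d
sum-map-+ d [] = sym (+-identityʳ d)
sum-map-+ {suc r} d (k ∷ v) = begin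
  d + k + sum (map (d +_) v) + d      ≡⟨ +-assoc (d + k) _ d ⟩
  d + k + (sum (map (d +_) v) + d)    ≡⟨ cong₂ _+_ (+-comm d k) (sum-map-+ d v) ⟩
  k + d + (sum v + suc r * d)         ≡⟨ +-assoc k d _ ⟩
  k + (d + (sum v + suc r * d))       ≡⟨ cong (k +_) (sym (+-assoc d (sum v) _)) ⟩
  k + (d + sum v + suc r * d)         ≡⟨ cong (λ z → k + (z + suc r * d)) (+-comm d (sum v)) ⟩
  k + (sum v + d + suc r * d)         ≡⟨ cong (k +_) (+-assoc (sum v) d _) ⟩
  k + (sum v + (d + suc r * d))       ≡⟨ +-assoc k (sum v) _ ⟨
  k + sum v + (d + suc r * d)         ∎
  where open ≡-Reasoning

map-+-∸ : {ks : Vec ℕ r} → All (d ≤_) ks → map (d +_) (map (_∸ d) ks) ≡ ks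
map-+-∸ []       = refl
map-+-∸ (p ∷ ps) = cong₂ _∷_ (m+[n∸m]≡n p) (map-+-∸ ps)

map-+-≥ : (d : ℕ) (v : Vec ℕ r) → All (d ≤_) (map (d +_) v)
map-+-≥ d []      = []
map-+-≥ d (k ∷ v) = m≤m+n d k ∷ map-+-≥ d v

-- Lowering every increment by its minimum d leaves r unconstrained numbers with total at most m -
-- sd.
increments↔boundedSum : suc r * d ≤ suc n → Increments r d n ↔ BoundedSum r (suc n ∸ suc r * d)
increments↔boundedSum {r} {d} {n} sd≤m = mk↔ₛ′
  (λ { (ks , [ h ]) → map (_∸ d) ks , [ shrink ks (proj₁ h) (proj₂ h) ] })
  (λ { (v , [ h ]) → map (d +_) v , [ (map-+-≥ d v , grow v h) ] })
  (λ { (v , [ h ]) → value-injective (trans (sym (map-∘ (_∸ d) (d +_) v))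
                       (trans (map-cong (m+n∸m≡n d) v) (map-id v))) })
  (λ { (ks , [ h ]) → value-injective (recompute (Vec.≡-dec _≟_ _ ks) (map-+-∸ (proj₁ h))) })
  where
  grow : (v : Vec ℕ r) → sum v ≤ suc n ∸ suc r * d → sum (map (d +_) v) + d ≤ suc n
  -- Here sd ≤ m matters: for sd > m the truncated difference would be 0 and still admit the zero
  -- vector, although no increments exist.
  grow v h = subst (_≤ suc n) (sym (sum-map-+ d v)) (m≤o∸n⇒m+n≤o (sum v) sd≤m h)
  shrink : (ks : Vec ℕ r) → All (d ≤_) ks → sum ks + d ≤ suc n →
           sum (map (_∸ d) ks) ≤ suc n ∸ suc r * d
  shrink ks ≥d ≤m = m+n≤o⇒m≤o∸n (sum (map (_∸ d) ks)) (subst (_≤ suc n)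
    (trans (cong (λ ks → sum ks + d) (sym (map-+-∸ ≥d))) (sum-map-+ d (map (_∸ d) ks))) ≤m)

increments↔Fin : suc r * d ≤ suc n →
                 Increments r d n ↔ Fin ((suc n ∸ suc r * d + suc r ∸ 1) C r)
increments↔Fin {r} {d} {n} sd≤m = ↔-trans (increments↔boundedSum sd≤m)
  (↔-trans (boundedSum↔Fin r N) (≡⇒Fin↔ (cong (λ z → (z ∸ 1) C r) (sym (+-suc N r)))))
  where N = suc n ∸ suc r * d

-- Counting preferences by the anchor of the first car

vec↔Fin : {A : Set} → A ↔ Fin k → ∀ l → Vec A l ↔ Fin (k ^ l)
vec↔Fin A↔ zero    = ↔-trans (mk↔ₛ′ (λ _ → tt) (λ _ → []) (λ _ → refl) (λ { [] → refl })) (↔-sym 1↔⊤)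
vec↔Fin A↔ (suc l) = ↔-trans
  (mk↔ₛ′ (λ { (x ∷ xs) → x , xs }) (λ { (x , xs) → x ∷ xs }) (λ { (_ , _) → refl }) (λ { (_ ∷ _) → refl }))
  (↔-trans (A↔ ×-↔ vec↔Fin A↔ l) (↔-sym *↔×))

firstAnchor : Vec (AdmissibleTuple r d n) (suc l) → Fin (suc n)
firstAnchor (t ∷ _) = head (value t)

firstAnchor-rotate : (A : Vec (AdmissibleTuple r d n) (suc l)) (k : ℕ) →
                     firstAnchor (rotateAll k A) ≡ firstAnchor A ⊕ k
firstAnchor-rotate (t ∷ _) k = head-rotate k (value t)

-- With its anchor prescribed, the first car keeps only the choice of its increments, while the
-- other l cars remain arbitrary.
firstAnchor-fibre↔ : 1 ≤ d → (a : Fin (suc n)) →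
  (Σ[ A ∈ Vec (AdmissibleTuple r d n) (suc l) ] firstAnchor A ≡ a) ↔
  (Increments r d n × Vec (AdmissibleTuple r d n) l)
firstAnchor-fibre↔ {d} {n} {r} 1≤d a = mk↔ₛ′
  (λ { (t ∷ A , _) → proj₂ (to t) , A })
  (λ { (ks , A) → from (a , ks) ∷ A , cong proj₁ (strictlyInverseˡ (a , ks)) })
  (λ { (ks , A) → cong (λ x → proj₂ x , A) (strictlyInverseˡ (a , ks)) })
  (λ { (t ∷ A , refl) → fibre-≡ (cong (_∷ A) (strictlyInverseʳ t)) })
  where open Inverse (tuple↔anchor×increments 1≤d {r} {n})

^-distribʳ-* : ∀ k m n → (m * n) ^ k ≡ m ^ k * n ^ k
^-distribʳ-* zero    m n = refl
^-distribʳ-* (suc k) m n = trans (cong (m * n *_) (^-distribʳ-* k m n)) (interchange m n (m ^ k) (n ^ k))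

theorem1 : ∀ (r d n : ℕ) → let s = suc r in let m = suc n in
    1 ≤ d → 2 ≤ m → s * d ≤ m → ∀ (j : Fin m) →
    (Σ[ A ∈ CircularPreference r d n ] E A ≡ j) ↔
    Fin (m ^ (n ∸ 1) * ((m ∸ s * d + s ∸ 1) C (s ∸ 1)) ^ n)
-- Without cars there is no first anchor; m would be 1, against 2 ≤ m.
theorem1 r d zero    1≤d (s≤s ()) sd≤m j
theorem1 r d (suc l) 1≤d 2≤m sd≤m j =
  ↔-trans (equivariant-fibres-↔ (λ A k → rotateAll k A) rotateAll-assoc rotateAll-trivial
             E firstAnchor E-rotate firstAnchor-rotate j zero)
  (↔-trans (firstAnchor-fibre↔ 1≤d zero)
  (↔-trans (increments↔Fin sd≤m ×-↔ vec↔Fin tuple↔Fin l)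
  (↔-trans (↔-sym *↔×) (≡⇒Fin↔ count))))
  where
  m = suc (suc l)
  X = (m ∸ suc r * d + suc r ∸ 1) C r

  tuple↔Fin : AdmissibleTuple r d (suc l) ↔ Fin (m * X)
  tuple↔Fin = ↔-trans (tuple↔anchor×increments 1≤d)
    (↔-trans (↔-refl ×-↔ increments↔Fin sd≤m) (↔-sym *↔×))

  -- The first car contributes X and each of the remaining l = n - 1 cars contributes `m * X`; hence
  -- the exponent n - 1 of m.
  count : X * (m * X) ^ l ≡ m ^ l * X ^ suc l
  count = trans (cong (X *_) (^-distribʳ-* l m X)) (x∙yz≈y∙xz X (m ^ l) (X ^ l))
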